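{- For every problem $f$: (1) $\Pi\Sigma f\leq_{\mathrm{sW}}\Sigma\Pi f$; (2) $\Pi\Sigma\Pi f\equiv_{\mathrm{sW}}\Sigma\Pi f$; (3) $\Sigma\Pi\Sigma f\equiv_{\mathrm{sW}}\Pi\Sigma f$.
   Context: A represented space is a set $X$ with a partial surjective map $\delta_X:\subseteq\mathbb N^{\mathbb N}\to X$. A problem is a partial multi-valued function $f:\subseteq X\rightrightarrows Y$ between represented spaces that has a realizer; a realizer of $f$ is a function $F:\subseteq\mathbb N^{\mathbb N}\to\mathbb N^{\mathbb N}$ with $\delta_YF(p)\in f\delta_X(p)$ for all $p\in\mathrm{dom}(f\delta_X)$. For problems $f,g$: $f\leq_{\mathrm{sW}}g$ if there are computable $H,K:\subseteq\mathbb N^{\mathbb N}\to\mathbb N^{\mathbb N}$ such that $HGK$ is a realizer of $f$ whenever $G$ is a realizer of $g$; $f\equiv_{\mathrm{sW}}g$ means $f\leq_{\mathrm{sW}}g$ and $g\leq_{\mathrm{sW}}f$. For a represented space $Y$, the completion $\overline Y:=Y\cup\{\bot\}$ ($\bot\notin Y$) is represented by the total map $\delta_{\overline Y}$ with $\delta_{\overline Y}(p)=\delta_Y(p-1)$ if $p-1\in\mathrm{dom}(\delta_Y)$ and $\delta_{\overline Y}(p)=\bot$ otherwise, where $p-1\in\mathbb N^{\mathbb N}\cup\mathbb N^*$ is the concatenation of $p(0)-1,p(1)-1,\dots$ and $0-1$ is the empty word. $X^{\mathbb N}$ is represented by $\langle p_0,p_1,\dots\rangle\mapsto(\delta_X(p_n))_n$,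 where $\langle p_0,p_1,\dots\rangle\langle n,k\rangle:=p_n(k)$ and $\langle n,k\rangle:=\frac12(n+k)(n+k+1)+k$ for $n,k\in\mathbb N$. For $f:\subseteq X\rightrightarrows Y$: the parallelization $\Pi f:\subseteq X^{\mathbb N}\rightrightarrows Y^{\mathbb N}$ has domain $\mathrm{dom}(f)^{\mathbb N}$ and $\Pi f((x_n)_n)=\{(y_n)_n:(\forall n)\ y_n\in f(x_n)\}$; the stashing $\Sigma f:\subseteq X^{\mathbb N}\rightrightarrows\overline Y^{\mathbb N}$ has domain $\mathrm{dom}(f)^{\mathbb N}$ and $\Sigma f((x_n)_n)=\{(y_n)_n\in\overline Y^{\mathbb N}:(\exists n)\ y_n\in f(x_n)\}$. Words such as $\Pi\Sigma f$ denote iterated application, $\Pi\Sigma f=\Pi(\Sigma f)$. -}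

module Defs where

open import Axiom.ExcludedMiddle using (ExcludedMiddle)
open import Data.Empty using (⊥-elim)
open import Data.Fin.Base using (Fin)
open import Data.List.Base using (List; []; _∷_; _++_; applyUpTo; concatMap; drop; head)
open import Data.List.Properties using (++-assoc)
open import Data.Maybe.Base using (Maybe; just; nothing)
open import Data.Maybe.Properties using (just-injective)
open import Data.Maybe.Relation.Binary.Pointwise as Pointwise using (just; nothing)
open import Data.Maybe.Relation.Unary.Any using (Any; just)
open import Data.Nat.Base using (ℕ; zero; suc; _+_; _*_; _/_; _<_; _≤_; z≤n; s≤s)
open import Data.Nat.Divisibility using (divides)
open import Data.Nat.DivMod using (+-distrib-/-∣ʳ; m*n/n≡m)
open import Data.Nat.Properties
  using (+-suc; +-identityʳ; suc-injective; ≤-total; n<1+n)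
open import Data.Nat.Tactic.RingSolver using (solve-∀)
open import Data.Product.Base using (∃; ∃₂; _×_; _,_; proj₁; proj₂)
open import Data.Sum.Base using (inj₁; inj₂)
open import Data.Vec.Base using (Vec; []; _∷_; lookup)
open import Function.Base using (_∘_)
open import Level using (Level; _⊔_; 0ℓ) renaming (suc to lsuc)
open import Relation.Binary.Bundles using (Setoid)
open import Relation.Binary.PropositionalEquality
  using (_≡_; refl; sym; trans; cong; cong₂; subst; _≗_; _→-setoid_; module ≡-Reasoning)
open import Relation.Nullary.Decidable.Core using (yes; no)
open import Relation.Nullary.Negation using (¬_)

private
  variable
    a b c ℓ ℓ₁ ℓ₂ : Level

Baire : Set
Baire = ℕ → ℕ

𝔹 : Setoid 0ℓ 0ℓ
𝔹 = ℕ →-setoid ℕ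

-- Partial single-valued maps are given by their graphs.

record PartialMap (A : Setoid a ℓ₁) (B : Setoid b ℓ₂) (ℓ : Level)
       : Set (a ⊔ b ⊔ ℓ₁ ⊔ ℓ₂ ⊔ lsuc ℓ) where
  private
    module A = Setoid A
    module B = Setoid B
  field
    graph        : A.Carrier → B.Carrier → Set ℓ
    respects     : ∀ {x x′ y y′} → x A.≈ x′ → y B.≈ y′ → graph x y → graph x′ y′
    singleValued : ∀ {x y y′} → graph x y → graph x y′ → y B.≈ y′

infixr 9 _∘ₚ_

_∘ₚ_ : {A : Setoid a ℓ} {B : Setoid b ℓ} {C : Setoid c ℓ} →
       PartialMap B C ℓ₁ → PartialMap A B ℓ₂ → PartialMap A C (b ⊔ ℓ₁ ⊔ ℓ₂)
_∘ₚ_ {A = A} {B} {C} G F = record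
  { graph        = λ x z → ∃ λ y → F.graph x y × G.graph y z
  ; respects     = λ x≈x′ z≈z′ (y , xy , yz) →
                     y , F.respects x≈x′ (Setoid.refl B) xy
                       , G.respects (Setoid.refl B) z≈z′ yz
  ; singleValued = λ (_ , xy , yz) (_ , xy′ , yz′) →
                     G.singleValued yz
                       (G.respects (F.singleValued xy′ xy) (Setoid.refl C) yz′)
  }
  where
  module F = PartialMap F
  module G = PartialMap G

-- Computability on Baire space: μ-recursive functionals with an oracle.
-- A code of arity n denotes, relative to an oracle p, a partial function ℕⁿ → ℕ.

data Code : ℕ → Set where
  zeroᶜ   : ∀ {n} → Code n
  sucᶜ    : Code 1
  projᶜ   : ∀ {n} → Fin n → Code n
  oracleᶜ : Code 1
  compᶜ   : ∀ {m n} → Code m → Vec (Code n) m → Code n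
  precᶜ   : ∀ {n} → Code n → Code (2 + n) → Code (1 + n)
  muᶜ     : ∀ {n} → Code (1 + n) → Code n

infix 4 _⊢_·_⇓_

data _⊢_·_⇓_ (p : Baire) : ∀ {n} → Code n → Vec ℕ n → ℕ → Set where
  ⇓zero   : ∀ {n} {xs : Vec ℕ n} → p ⊢ zeroᶜ · xs ⇓ 0
  ⇓suc    : ∀ {x} → p ⊢ sucᶜ · x ∷ [] ⇓ suc x
  ⇓proj   : ∀ {n} {xs : Vec ℕ n} (i : Fin n) → p ⊢ projᶜ i · xs ⇓ lookup xs i
  ⇓oracle : ∀ {x} → p ⊢ oracleᶜ · x ∷ [] ⇓ p x
  ⇓comp   : ∀ {m n} {f : Code m} {gs : Vec (Code n) m} {xs ys z} →
            (∀ i → p ⊢ lookup gs i · xs ⇓ lookup ys i) →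
            p ⊢ f · ys ⇓ z →
            p ⊢ compᶜ f gs · xs ⇓ z
  ⇓prec0  : ∀ {n} {f : Code n} {g xs z} →
            p ⊢ f · xs ⇓ z →
            p ⊢ precᶜ f g · 0 ∷ xs ⇓ z
  ⇓precS  : ∀ {n} {f : Code n} {g xs k y z} →
            p ⊢ precᶜ f g · k ∷ xs ⇓ y →
            p ⊢ g · k ∷ y ∷ xs ⇓ z →
            p ⊢ precᶜ f g · suc k ∷ xs ⇓ z
  ⇓mu     : ∀ {n} {f : Code (1 + n)} {xs k} →
            (∀ i → i < k → ∃ λ v → p ⊢ f · i ∷ xs ⇓ suc v) →
            p ⊢ f · k ∷ xs ⇓ 0 →
            p ⊢ muᶜ f · xs ⇓ k

-- As usual, the algorithm is unconstrained on oracles outside the domain.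

Computable : PartialMap 𝔹 𝔹 ℓ → Set ℓ
Computable F = ∃ λ (e : Code 1) →
  ∀ {p q} → PartialMap.graph F p q → ∀ n → p ⊢ e · n ∷ [] ⇓ q n

record RepresentedSpace (ℓ : Level) : Set (lsuc ℓ) where
  field
    setoid     : Setoid ℓ ℓ
    δ          : PartialMap 𝔹 setoid ℓ
    surjective : ∀ x → ∃ λ p → PartialMap.graph δ p x

  open Setoid setoid public using (Carrier; _≈_)
  open PartialMap δ public
    renaming (graph to _names_; respects to names-resp; singleValued to names-unique)

record MultiMap (X Y : RepresentedSpace ℓ) : Set (lsuc ℓ) where
  private
    module X = RepresentedSpace X
    module Y = RepresentedSpace Y
  field
    _↦_    : X.Carrier → Y.Carrier → Set ℓ
    ↦-resp : ∀ {x x′ y y′} → x X.≈ x′ → y Y.≈ y′ → x ↦ y → x′ ↦ y′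

  Dom : X.Carrier → Set ℓ
  Dom x = ∃ λ y → x ↦ y

_Realizes_ : {X Y : RepresentedSpace ℓ} → PartialMap 𝔹 𝔹 ℓ → MultiMap X Y → Set ℓ
_Realizes_ {X = X} {Y} F f =
  ∀ {p x} → p X.names x → Dom x →
  ∃₂ λ q y → PartialMap.graph F p q × q Y.names y × x ↦ y
  where
  module X = RepresentedSpace X
  module Y = RepresentedSpace Y
  open MultiMap f

record Problem (X Y : RepresentedSpace ℓ) : Set (lsuc ℓ) where
  field
    multiMap   : MultiMap X Y
    realizable : ∃ λ F → F Realizes multiMap

  open MultiMap multiMap public

infix 4 _≤ₛW_ _≡ₛW_

_≤ₛW_ : {X Y X′ Y′ : RepresentedSpace ℓ} → Problem X Y → Problem X′ Y′ → Set (lsuc ℓ)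
_≤ₛW_ {ℓ} f g = ∃₂ λ (H K : PartialMap 𝔹 𝔹 ℓ) →
  Computable H × Computable K ×
  (∀ (G : PartialMap 𝔹 𝔹 ℓ) → G Realizes Problem.multiMap g →
     (H ∘ₚ G ∘ₚ K) Realizes Problem.multiMap f)

_≡ₛW_ : {X Y X′ Y′ : RepresentedSpace ℓ} → Problem X Y → Problem X′ Y′ → Set (lsuc ℓ)
f ≡ₛW g = f ≤ₛW g × g ≤ₛW f

⟨_,_⟩ : ℕ → ℕ → ℕ
⟨ n , k ⟩ = (n + k) * (n + k + 1) / 2 + k

⟨⟩-sucʳ : ∀ n k → ⟨ n , suc k ⟩ ≡ suc ⟨ suc n , k ⟩
⟨⟩-sucʳ n k rewrite +-suc n k = +-suc ((suc (n + k) * (suc (n + k) + 1)) / 2) k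

⟨⟩-wrap : ∀ n → ⟨ suc n , 0 ⟩ ≡ suc ⟨ 0 , n ⟩
⟨⟩-wrap n = begin
  (suc n + 0) * (suc n + 0 + 1) / 2 + 0  ≡⟨ +-identityʳ _ ⟩
  (suc n + 0) * (suc n + 0 + 1) / 2      ≡⟨ cong (_/ 2) (expand n) ⟩
  (n * (n + 1) + suc n * 2) / 2          ≡⟨ +-distrib-/-∣ʳ (n * (n + 1)) (divides (suc n) refl) ⟩
  n * (n + 1) / 2 + suc n * 2 / 2        ≡⟨ cong (n * (n + 1) / 2 +_) (m*n/n≡m (suc n) 2) ⟩
  n * (n + 1) / 2 + suc n                ≡⟨ +-suc _ n ⟩
  suc (n * (n + 1) / 2 + n)              ∎
  where
  open ≡-Reasoning
  expand : ∀ n → (suc n + 0) * (suc n + 0 + 1) ≡ n * (n + 1) + suc n * 2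
  expand = solve-∀

next : ℕ × ℕ → ℕ × ℕ
next (zero  , k) = suc k , zero
next (suc n , k) = n , suc k

unpair : ℕ → ℕ × ℕ
unpair zero    = 0 , 0
unpair (suc m) = next (unpair m)

unpair-⟨⟩ : ∀ n k → unpair ⟨ n , k ⟩ ≡ (n , k)
unpair-⟨⟩ n k = go _ n k refl
  where
  go : ∀ m n k → ⟨ n , k ⟩ ≡ m → unpair m ≡ (n , k)
  go zero    zero    zero    _  = refl
  go zero    (suc n) zero    eq with () ← trans (sym (⟨⟩-wrap n)) eq
  go zero    n       (suc k) eq with () ← trans (sym (⟨⟩-sucʳ n k)) eq
  go (suc m) (suc n) zero    eq =
    cong next (go m 0 n (suc-injective (trans (sym (⟨⟩-wrap n)) eq)))
  go (suc m) n       (suc k) eq =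
    cong next (go m (suc n) k (suc-injective (trans (sym (⟨⟩-sucʳ n k)) eq)))

⟨⟩-unpair : ∀ m → ⟨ proj₁ (unpair m) , proj₂ (unpair m) ⟩ ≡ m
⟨⟩-unpair zero    = refl
⟨⟩-unpair (suc m) = trans (step (unpair m)) (cong suc (⟨⟩-unpair m))
  where
  step : ∀ nk → ⟨ proj₁ (next nk) , proj₂ (next nk) ⟩ ≡ suc ⟨ proj₁ nk , proj₂ nk ⟩
  step (zero  , k) = ⟨⟩-wrap k
  step (suc n , k) = ⟨⟩-sucʳ n k

-- The pairing is a bijection, so p = ⟨p₀,p₁,…⟩ holds exactly for pₙ = component p n.

component : Baire → ℕ → Baire
component p n k = p ⟨ n , k ⟩

tuple : (ℕ → Baire) → Baire
tuple ps m = ps (proj₁ (unpair m)) (proj₂ (unpair m))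

component-tuple : ∀ ps n → component (tuple ps) n ≗ ps n
component-tuple ps n k = cong (λ nk → ps (proj₁ nk) (proj₂ nk)) (unpair-⟨⟩ n k)

component-injective : ∀ {p q} → (∀ n → component p n ≗ component q n) → p ≗ q
component-injective {p} {q} eq m =
  subst (λ i → p i ≡ q i) (⟨⟩-unpair m) (eq (proj₁ (unpair m)) (proj₂ (unpair m)))

seqSetoid : Setoid a ℓ → Setoid a ℓ
seqSetoid A = record
  { Carrier       = ℕ → A.Carrier
  ; _≈_           = λ xs ys → ∀ n → xs n A.≈ ys n
  ; isEquivalence = record
    { refl  = λ _ → A.refl
    ; sym   = λ eq n → A.sym (eq n)
    ; trans = λ eq eq′ n → A.trans (eq n) (eq′ n)
    }
  }
  where module A = Setoid A

infix 10 _^ℕ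

_^ℕ : RepresentedSpace ℓ → RepresentedSpace ℓ
X ^ℕ = record
  { setoid     = seqSetoid X.setoid
  ; δ          = record
    { graph        = λ p xs → ∀ n → component p n X.names xs n
    ; respects     = λ p≗p′ xs≈xs′ names n →
                       X.names-resp (λ k → p≗p′ ⟨ n , k ⟩) (xs≈xs′ n) (names n)
    ; singleValued = λ names names′ n → X.names-unique (names n) (names′ n)
    }
  ; surjective = λ xs →
      tuple (λ n → proj₁ (X.surjective (xs n))) ,
      λ n → X.names-resp (λ k → sym (component-tuple (λ n → proj₁ (X.surjective (xs n))) n k)) (Setoid.refl X.setoid)
              (proj₂ (X.surjective (xs n)))
  }
  where module X = RepresentedSpace X

-- The word p(0)−1 p(1)−1 … p(m−1)−1, where 0−1 is the empty word.

letter : ℕ → List ℕ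
letter zero    = []
letter (suc n) = n ∷ []

decrementUpTo : Baire → ℕ → List ℕ
decrementUpTo p m = concatMap letter (applyUpTo p m)

-- p −1≐ q says that p−1 is infinite and equal to q.

infix 4 _−1≐_

_−1≐_ : Baire → Baire → Set
p −1≐ q = ∀ k → ∃₂ λ m w → decrementUpTo p m ≡ applyUpTo q k ++ w

applyUpTo-cong : ∀ {p q : Baire} → p ≗ q → applyUpTo p ≗ applyUpTo q
applyUpTo-cong eq zero    = refl
applyUpTo-cong eq (suc k) = cong₂ _∷_ (eq 0) (applyUpTo-cong (eq ∘ suc) k)

−1≐-resp : ∀ {p p′ q q′} → p ≗ p′ → q ≗ q′ → p −1≐ q → p′ −1≐ q′
−1≐-resp p≗p′ q≗q′ pq k with m , w , eq ← pq k =
  m , w , trans (cong (concatMap letter) (sym (applyUpTo-cong p≗p′ m)))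
            (trans eq (cong (_++ w) (applyUpTo-cong q≗q′ k)))

decrementUpTo-mono : ∀ p {m m′} → m ≤ m′ → ∃ λ w → decrementUpTo p m′ ≡ decrementUpTo p m ++ w
decrementUpTo-mono p z≤n = _ , refl
decrementUpTo-mono p {suc m} {suc m′} (s≤s m≤m′)
  with w , eq ← decrementUpTo-mono (p ∘ suc) m≤m′ =
  w , trans (cong (letter (p 0) ++_) eq) (sym (++-assoc (letter (p 0)) _ w))

lookup-prefix : ∀ (q : Baire) {i k} w → i < k → head (drop i (applyUpTo q k ++ w)) ≡ just (q i)
lookup-prefix q {zero}  w (s≤s _)   = refl
lookup-prefix q {suc i} w (s≤s i<k) = lookup-prefix (q ∘ suc) w i<k

decrement-compare : ∀ p {q q′ : Baire} {i m m′ w w′} →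
          decrementUpTo p m ≡ applyUpTo q (suc i) ++ w →
          decrementUpTo p m′ ≡ applyUpTo q′ (suc i) ++ w′ →
          m ≤ m′ → q i ≡ q′ i
decrement-compare p {q} {q′} {i} {m} {m′} {w} {w′} eq eq′ m≤m′ with v , ext ← decrementUpTo-mono p m≤m′ =
  just-injective (begin
    just (q i)                                       ≡⟨ lookup-prefix q (w ++ v) (n<1+n i) ⟨
    head (drop i (applyUpTo q (suc i) ++ w ++ v))    ≡⟨ cong (head ∘ drop i) (++-assoc (applyUpTo q (suc i)) w v) ⟨
    head (drop i ((applyUpTo q (suc i) ++ w) ++ v))  ≡⟨ cong (λ u → head (drop i (u ++ v))) eq ⟨
    head (drop i (decrementUpTo p m ++ v))           ≡⟨ cong (head ∘ drop i) ext ⟨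
    head (drop i (decrementUpTo p m′))               ≡⟨ cong (head ∘ drop i) eq′ ⟩
    head (drop i (applyUpTo q′ (suc i) ++ w′))       ≡⟨ lookup-prefix q′ w′ (n<1+n i) ⟩
    just (q′ i)                                      ∎)
  where open ≡-Reasoning

−1≐-unique : ∀ {p q q′} → p −1≐ q → p −1≐ q′ → q ≗ q′
−1≐-unique {p} {q} {q′} pq pq′ i with pq (suc i) | pq′ (suc i)
... | m , _ , eq | m′ , _ , eq′ with ≤-total m m′
...   | inj₁ m≤m′ = decrement-compare p {q} {q′} eq eq′ m≤m′
...   | inj₂ m′≤m = sym (decrement-compare p {q′} {q} eq′ eq m′≤m)

suc∘-−1≐ : ∀ q → suc ∘ q −1≐ q
suc∘-−1≐ q k = k , [] , lemma q k
  where
  lemma : ∀ q k → decrementUpTo (suc ∘ q) k ≡ applyUpTo q k ++ []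
  lemma q zero    = refl
  lemma q (suc k) = cong (q 0 ∷_) (lemma (q ∘ suc) k)

0-−1-finite : ∀ {q} → ¬ ((λ _ → 0) −1≐ q)
0-−1-finite zeros = let (m , _ , eq) = zeros 1 in nonempty (trans (sym (empty m)) eq)
  where
  empty : ∀ m → decrementUpTo (λ _ → 0) m ≡ []
  empty zero    = refl
  empty (suc m) = empty m

  nonempty : ∀ {n : ℕ} {w : List ℕ} → ¬ ([] ≡ n ∷ w)
  nonempty ()

-- The added point ⊥ is nothing.

completion : RepresentedSpace ℓ → RepresentedSpace ℓ
completion {ℓ} Y = record
  { setoid     = Pointwise.setoid Y.setoid
  ; δ          = record
    { graph        = graph
    ; respects     = respects
    ; singleValued = singleValued
    }
  ; surjective = surjective
  }
  where
  module Y = RepresentedSpace Y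
  open Setoid (Pointwise.setoid Y.setoid) using () renaming (_≈_ to _≈⊥_)

  graph : Baire → Maybe Y.Carrier → Set ℓ
  graph p (just y) = ∃ λ q → p −1≐ q × q Y.names y
  graph p nothing  = ¬ (∃₂ λ q y → p −1≐ q × q Y.names y)

  respects : ∀ {p p′ y y′} → p ≗ p′ → y ≈⊥ y′ → graph p y → graph p′ y′
  respects p≗p′ (just y≈y′) (q , pq , qy) =
    q , −1≐-resp p≗p′ (λ _ → refl) pq , Y.names-resp (λ _ → refl) y≈y′ qy
  respects p≗p′ nothing undefined (q , y , pq , qy) =
    undefined (q , y , −1≐-resp (sym ∘ p≗p′) (λ _ → refl) pq , qy)

  singleValued : ∀ {p y y′} → graph p y → graph p y′ → y ≈⊥ y′
  singleValued {y = just _} {just _} (_ , pq , qy) (_ , pq′ , q′y′) =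
    just (Y.names-unique qy
           (Y.names-resp (−1≐-unique pq′ pq) (Setoid.refl Y.setoid) q′y′))
  singleValued {y = just y} {nothing} (q , pq , qy) undefined =
    ⊥-elim (undefined (q , y , pq , qy))
  singleValued {y = nothing} {just y} undefined (q , pq , qy) =
    ⊥-elim (undefined (q , y , pq , qy))
  singleValued {y = nothing} {nothing} _ _ = nothing

  surjective : ∀ y → ∃ λ p → graph p y
  surjective (just y) with q , qy ← Y.surjective y = suc ∘ q , q , suc∘-−1≐ q , qy
  surjective nothing  = (λ _ → 0) , λ (_ , _ , zeros , _) → 0-−1-finite zeros

-- Deciding whether p−1 ∈ dom(δ) is not constructive.

completion-total : ExcludedMiddle ℓ → (Y : RepresentedSpace ℓ) →
                   ∀ p → ∃ λ y → RepresentedSpace._names_ (completion Y) p y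
completion-total em Y p
  with em {∃₂ λ q y → p −1≐ q × RepresentedSpace._names_ Y q y}
... | yes (q , y , pq , qy) = just y , q , pq , qy
... | no undefined          = nothing , undefined

-- A family of witnesses of xs n ∈ dom(f) is a point of the solution set, so the
-- domain is dom(f)^ℕ without further conditions.

Π : {X Y : RepresentedSpace ℓ} → Problem X Y → Problem (X ^ℕ) (Y ^ℕ)
Π {X = X} {Y} f = record
  { multiMap   = record
    { _↦_    = λ xs ys → ∀ n → xs n f.↦ ys n
    ; ↦-resp = λ xs≈xs′ ys≈ys′ xs↦ys n → f.↦-resp (xs≈xs′ n) (ys≈ys′ n) (xs↦ys n)
    }
  ; realizable =
      record
        { graph        = λ p q → ∀ n → F.graph (component p n) (component q n)
        ; respects     = λ p≗p′ q≗q′ pq n →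
                           F.respects (λ k → p≗p′ ⟨ n , k ⟩) (λ k → q≗q′ ⟨ n , k ⟩) (pq n)
        ; singleValued = λ pq pq′ → component-injective (λ n → F.singleValued (pq n) (pq′ n))
        } ,
      λ names (ys , xs↦ys) →
        let result n = F-realizes (names n) (ys n , xs↦ys n)
            qs n     = proj₁ (result n)
            ≗qs n k  = sym (component-tuple qs n k)
        in tuple qs
         , (λ n → proj₁ (proj₂ (result n)))
         , (λ n → F.respects (λ _ → refl) (≗qs n) (proj₁ (proj₂ (proj₂ (result n)))))
         , (λ n → Y.names-resp (≗qs n) (Setoid.refl Y.setoid)
                    (proj₁ (proj₂ (proj₂ (proj₂ (result n))))))
         , (λ n → proj₂ (proj₂ (proj₂ (proj₂ (result n)))))
  }
  where
  module Y = RepresentedSpace Y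
  module f = Problem f
  F          = proj₁ f.realizable
  F-realizes = proj₂ f.realizable
  module F = PartialMap F

-- Any (x ↦_) y⊥ says that y⊥ ∈ Y ∪ {⊥} is an element of Y with x ↦ y⊥.
-- The first conjunct makes the domain dom(f)^ℕ.

Σ : {X Y : RepresentedSpace ℓ} → Problem X Y → Problem (X ^ℕ) (completion Y ^ℕ)
Σ {X = X} {Y} f = record
  { multiMap   = record
    { _↦_    = λ xs ys → (∀ n → f.Dom (xs n)) × ∃ λ n → Any (xs n f.↦_) (ys n)
    ; ↦-resp = λ xs≈xs′ ys≈ys′ (dom , n , hit) →
        (λ n → let (y , x↦y) = dom n in
               y , f.↦-resp (xs≈xs′ n) (Setoid.refl Y.setoid) x↦y) ,
        n , any-resp (xs≈xs′ n) (ys≈ys′ n) hit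
    }
  ; realizable =
      record
        { graph        = λ p q → ∀ n → ∃ λ r → F.graph (component p n) r × component q n ≗ suc ∘ r
        ; respects     = λ p≗p′ q≗q′ pq n → let (r , pr , q≗r) = pq n in
                           r , F.respects (λ k → p≗p′ ⟨ n , k ⟩) (λ _ → refl) pr
                             , λ k → trans (sym (q≗q′ ⟨ n , k ⟩)) (q≗r k)
        ; singleValued = λ pq pq′ → component-injective λ n k →
            let (_ , pr , q≗r) = pq n ; (_ , pr′ , q′≗r′) = pq′ n in
            trans (q≗r k) (trans (cong suc (F.singleValued pr pr′ k)) (sym (q′≗r′ k)))
        } ,
      λ names (_ , dom , _) →
        let result n = F-realizes (names n) (dom n)
            rs n     = proj₁ (result n)
            qs n     = suc ∘ rs n
        in tuple qs
         , (λ n → just (proj₁ (proj₂ (result n))))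
         , (λ n → rs n , proj₁ (proj₂ (proj₂ (result n))) , component-tuple qs n)
         , (λ n → rs n
                , −1≐-resp (λ k → sym (component-tuple qs n k)) (λ _ → refl) (suc∘-−1≐ (rs n))
                , proj₁ (proj₂ (proj₂ (proj₂ (result n)))))
         , dom , 0 , just (proj₂ (proj₂ (proj₂ (proj₂ (result 0)))))
  }
  where
  module X = RepresentedSpace X
  module Y = RepresentedSpace Y
  module f = Problem f
  F          = proj₁ f.realizable
  F-realizes = proj₂ f.realizable
  module F = PartialMap F

  any-resp : ∀ {x x′ y y′} → x X.≈ x′ → Setoid._≈_ (Pointwise.setoid Y.setoid) y y′ →
             Any (x f.↦_) y → Any (x′ f.↦_) y′
  any-resp x≈x′ (just y≈y′) (just x↦y) = just (f.↦-resp x≈x′ y≈y′ x↦y)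

{-# OPTIONS --safe #-}
module Submission where

-- ΠΣ f reduces to ΣΠ f by transposing the matrix of instances: if the answer in place k is correct,
-- then it solves column k, and so every row is solved in place k. For ΠΣΠ f the same is done with
-- several sequences read as one, and for ΠΣ f ≤ ΣΠΣ f each row is itself folded into a matrix.
-- To turn a word p − 1 that may be finite into names of its parts, one computes from p a total name
-- of the subsequence (p − 1) ∘ φ, emitting 0 as long as the next letter has not been seen. The
-- other reductions are instances of g ≤ Π g and Σ g ≤ g.

open import Axiom.ExcludedMiddle using (ExcludedMiddle)
open import Data.Empty using (⊥-elim)
open import Data.Fin.Base using (Fin; zero; suc)
open import Data.Fin.Patterns using (0F; 1F; 2F)
open import Data.List.Base using (List; []; _∷_; _++_; applyUpTo; concatMap; length)
open import Data.List.Properties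
  using (applyUpTo-∷ʳ; concatMap-++; length-++; ++-assoc; ++-identityʳ)
open import Data.Maybe.Base using (Maybe; just; nothing)
open import Data.Maybe.Relation.Unary.Any using (Any; just)
open import Data.Nat.Base using (ℕ; zero; suc; pred; _+_; _∸_; _≤_)
open import Data.Nat.Properties
  using (+-comm; +-identityʳ; +-suc; <-cmp; m+n∸m≡n; m+n∸n≡m; m≤m+n; n∸n≡0; [m+n]∸[m+o]≡n∸o;
         pred[m∸n]≡m∸[1+n]; ≤-refl; ≤-total)
open import Data.Product.Base using (∃; ∃₂; _×_; _,_; proj₁; proj₂)
open import Data.Sum.Base using (_⊎_; inj₁; inj₂)
open import Data.Vec.Base using (Vec; []; _∷_; head; lookup; map; tabulate; tail)
open import Data.Vec.Properties using (lookup∘tabulate; tabulate-cong; tabulate∘lookup)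
open import Data.Vec.Relation.Unary.All using (All; []; _∷_; reduce)
open import Function.Base using (_∘_)
open import Level using (Level; Lift; lift)
open import Relation.Binary.Bundles using (Setoid)
open import Relation.Binary.Definitions using (tri<; tri≈; tri>)
open import Relation.Binary.PropositionalEquality
  using (_≡_; refl; sym; trans; cong; cong₂; subst; _≗_; module ≡-Reasoning)
open import Defs

private
  variable
    ℓ   : Level
    m n : ℕ

open ≡-Reasoning

-- Recursive functionals

-- Two pointwise equal oracles are allowed, instead of a single one, because this also gives the
-- extensionality of computed operators in `operator-cong` without function extensionality.
⇓-deterministic : ∀ {p p′} → p ≗ p′ → ∀ {e : Code n} {xs y y′} →
                  p ⊢ e · xs ⇓ y → p′ ⊢ e · xs ⇓ y′ → y ≡ y′
⇓-deterministic p≗p′ ⇓zero ⇓zero = refl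
⇓-deterministic p≗p′ ⇓suc ⇓suc = refl
⇓-deterministic p≗p′ (⇓proj i) (⇓proj .i) = refl
⇓-deterministic p≗p′ ⇓oracle ⇓oracle = p≗p′ _
⇓-deterministic {p′ = p′} p≗p′ (⇓comp {f = f} {ys = ys} gs⇓ f⇓) (⇓comp {ys = ys′} gs⇓′ f⇓′) =
  ⇓-deterministic p≗p′ f⇓ (subst (λ zs → p′ ⊢ f · zs ⇓ _) (sym ys≡ys′) f⇓′)
  where
  ys≡ys′ : ys ≡ ys′
  ys≡ys′ = begin
    ys                     ≡⟨ tabulate∘lookup ys ⟨
    tabulate (lookup ys)   ≡⟨ tabulate-cong (λ i → ⇓-deterministic p≗p′ (gs⇓ i) (gs⇓′ i)) ⟩
    tabulate (lookup ys′)  ≡⟨ tabulate∘lookup ys′ ⟩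
    ys′                    ∎
⇓-deterministic p≗p′ (⇓prec0 f⇓) (⇓prec0 f⇓′) = ⇓-deterministic p≗p′ f⇓ f⇓′
⇓-deterministic p≗p′ (⇓precS r⇓ g⇓) (⇓precS r⇓′ g⇓′)
  with refl ← ⇓-deterministic p≗p′ r⇓ r⇓′ = ⇓-deterministic p≗p′ g⇓ g⇓′
⇓-deterministic p≗p′ (⇓mu {k = k} below at) (⇓mu {k = k′} below′ at′) with <-cmp k k′
... | tri≈ _ k≡k′ _ = k≡k′
-- If the two minima differed, then at the smaller one the same code would yield both zero and a
-- successor.
... | tri< k<k′ _ _ with () ← ⇓-deterministic p≗p′ at (proj₂ (below′ k k<k′))
... | tri> _ _ k′<k with () ← ⇓-deterministic p≗p′ (proj₂ (below k′ k′<k)) at′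

Functional : ℕ → Set
Functional n = Baire → Vec ℕ n → ℕ

-- Pairs a code with the total functional that it computes, so that codes are assembled along the
-- shape of a functional and never evaluated by hand.
record Recursive {n} (F : Functional n) : Set where
  constructor _computedBy_
  field
    code     : Code n
    computes : ∀ p xs → p ⊢ code · xs ⇓ F p xs

open Recursive

recursive-≗ : {F G : Functional n} → (∀ p xs → F p xs ≡ G p xs) → Recursive F → Recursive G
recursive-≗ eq F .code = F .code
recursive-≗ eq F .computes p xs = subst (λ y → p ⊢ F .code · xs ⇓ y) (eq p xs) (F .computes p xs)

recursive-var : (i : Fin n) → Recursive (λ _ xs → lookup xs i)
recursive-var i = projᶜ i computedBy λ _ _ → ⇓proj i

recursive-zero : Recursive {n} (λ _ _ → 0)
recursive-zero = zeroᶜ computedBy λ _ _ → ⇓zero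

module _ {F : Functional n} (F-rec : Recursive F) where

  recursive-suc : Recursive (λ p xs → suc (F p xs))
  recursive-suc = compᶜ sucᶜ (F-rec .code ∷ []) computedBy λ p xs →
    ⇓comp {ys = F p xs ∷ []} (λ { 0F → F-rec .computes p xs }) ⇓suc

  recursive-oracle : Recursive (λ p xs → p (F p xs))
  recursive-oracle = compᶜ oracleᶜ (F-rec .code ∷ []) computedBy λ p xs →
    ⇓comp {ys = F p xs ∷ []} (λ { 0F → F-rec .computes p xs }) ⇓oracle

  recursive-weaken : Recursive (λ p xs → F p (tail xs))
  recursive-weaken = compᶜ (F-rec .code) (tabulate (projᶜ ∘ suc)) computedBy λ where
    p (x ∷ xs) → ⇓comp
      (λ i → subst (λ e → p ⊢ e · x ∷ xs ⇓ lookup xs i) (sym (lookup∘tabulate (projᶜ ∘ suc) i))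
               (⇓proj (suc i)))
      (F-rec .computes p xs)

recursive-let : {F : Functional (suc n)} {G : Functional n} → Recursive F → Recursive G →
                Recursive (λ p xs → F p (G p xs ∷ xs))
recursive-let {F = F} {G} F-rec G-rec =
  compᶜ (F-rec .code) (G-rec .code ∷ tabulate projᶜ) computedBy λ p xs → ⇓comp
    (λ { zero    → G-rec .computes p xs
       ; (suc i) → subst (λ e → p ⊢ e · xs ⇓ lookup xs i) (sym (lookup∘tabulate projᶜ i)) (⇓proj i) })
    (F-rec .computes p (G p xs ∷ xs))

recursive-comp : {F : Functional m} {Gs : Vec (Functional n) m} → Recursive F → All Recursive Gs →
                 Recursive (λ p xs → F p (map (λ G → G p xs) Gs))
recursive-comp F-rec Gs-rec = compᶜ (F-rec .code) (reduce code Gs-rec) computedBy λ p xs →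
  ⇓comp (go p xs Gs-rec) (F-rec .computes p _)
  where
  go : ∀ p xs {m} {Gs : Vec (Functional _) m} (Gs-rec : All Recursive Gs) i →
       p ⊢ lookup (reduce code Gs-rec) i · xs ⇓ lookup (map (λ G → G p xs) Gs) i
  go p xs (G-rec ∷ _)  zero    = G-rec .computes p xs
  go p xs (_ ∷ Gs-rec) (suc i) = go p xs Gs-rec i

primRec : ℕ → (ℕ → ℕ → ℕ) → ℕ → ℕ
primRec b s zero    = b
primRec b s (suc k) = s k (primRec b s k)

recursive-primRec : {B : Functional n} {S : Functional (2 + n)} {N : Functional n} →
                    Recursive B → Recursive S → Recursive N →
                    Recursive (λ p xs → primRec (B p xs) (λ k y → S p (k ∷ y ∷ xs)) (N p xs))
recursive-primRec {n} {B} {S} B-rec S-rec = recursive-let (precᶜ (B-rec .code) (S-rec .code) computedBy go)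
  where
  go : ∀ p (xs : Vec ℕ (suc n)) → p ⊢ precᶜ (B-rec .code) (S-rec .code) · xs ⇓
       primRec (B p (tail xs)) (λ k y → S p (k ∷ y ∷ tail xs)) (head xs)
  go p (zero  ∷ xs) = ⇓prec0 (B-rec .computes p xs)
  go p (suc k ∷ xs) = ⇓precS (go p (k ∷ xs)) (S-rec .computes p _)

-- Primitive recursive arithmetic, pairing and unpairing

if0 : ℕ → ℕ → ℕ → ℕ
if0 zero    a b = a
if0 (suc _) a b = b

-- The triangular number s(s + 1)/2, which is the index where the diagonal n + k = s begins. By
-- `triangle-suc` it can be computed by repeated addition, without division.
triangle : ℕ → ℕ
triangle s = ⟨ s , 0 ⟩

⟨⟩-triangle : ∀ n k → ⟨ n , k ⟩ ≡ triangle (n + k) + k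
⟨⟩-triangle n zero = trans (cong triangle (sym (+-identityʳ n))) (sym (+-identityʳ _))
⟨⟩-triangle n (suc k) = begin
  ⟨ n , suc k ⟩                      ≡⟨ ⟨⟩-sucʳ n k ⟩
  suc ⟨ suc n , k ⟩                  ≡⟨ cong suc (⟨⟩-triangle (suc n) k) ⟩
  suc (triangle (suc n + k) + k)     ≡⟨ +-suc _ k ⟨
  triangle (suc n + k) + suc k       ≡⟨ cong (λ s → triangle s + suc k) (+-suc n k) ⟨
  triangle (n + suc k) + suc k       ∎

triangle-suc : ∀ s → triangle (suc s) ≡ triangle s + suc s
triangle-suc s = trans (⟨⟩-wrap s) (trans (cong suc (⟨⟩-triangle 0 s)) (sym (+-suc _ s)))

-- Tracks n + k for the pair with index m. The truncated difference vanishes exactly when `suc m`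
-- has reached the start of the next diagonal. Both components of `unpair m` are then obtained by
-- subtraction.
diagonal : ℕ → ℕ
diagonal = primRec 0 λ m s → if0 (triangle (suc s) ∸ suc m) (suc s) s

diagonal-unpair : ∀ m → diagonal m ≡ proj₁ (unpair m) + proj₂ (unpair m)
diagonal-unpair zero = refl
diagonal-unpair (suc m) = begin
  step m (diagonal m)                            ≡⟨ cong (step m) (diagonal-unpair m) ⟩
  step m (l + r)                                 ≡⟨ cong (λ i → step i (l + r)) (⟨⟩-unpair m) ⟨
  step ⟨ l , r ⟩ (l + r)                         ≡⟨ cong (λ i → step i (l + r)) (⟨⟩-triangle l r) ⟩
  step (triangle (l + r) + r) (l + r)            ≡⟨ next-sum l r ⟩
  proj₁ (next (l , r)) + proj₂ (next (l , r))    ∎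
  where
  l = proj₁ (unpair m)
  r = proj₂ (unpair m)

  step : ℕ → ℕ → ℕ
  step m s = if0 (triangle (suc s) ∸ suc m) (suc s) s

  -- For s = l + r and k = r the tested difference becomes l, so the test succeeds exactly where
  -- `next` wraps around to a new diagonal.
  overshoot : ∀ s k → triangle (suc s) ∸ suc (triangle s + k) ≡ s ∸ k
  overshoot s k = begin
    triangle (suc s) ∸ suc (triangle s + k)    ≡⟨ cong₂ _∸_ (triangle-suc s) (sym (+-suc (triangle s) k)) ⟩
    triangle s + suc s ∸ (triangle s + suc k)  ≡⟨ [m+n]∸[m+o]≡n∸o (triangle s) (suc s) (suc k) ⟩
    s ∸ k                                      ∎

  next-sum : ∀ l r → step (triangle (l + r) + r) (l + r) ≡ proj₁ (next (l , r)) + proj₂ (next (l , r))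
  next-sum zero    r rewrite overshoot r r | n∸n≡0 r = cong suc (sym (+-identityʳ r))
  next-sum (suc l) r rewrite overshoot (suc l + r) r | m+n∸n≡m (suc l) r = sym (+-suc l r)

unpair₂ : ∀ m → m ∸ triangle (diagonal m) ≡ proj₂ (unpair m)
unpair₂ m rewrite diagonal-unpair m = begin
  m ∸ triangle (l + r)                       ≡⟨ cong (_∸ triangle (l + r)) (⟨⟩-unpair m) ⟨
  ⟨ l , r ⟩ ∸ triangle (l + r)               ≡⟨ cong (_∸ triangle (l + r)) (⟨⟩-triangle l r) ⟩
  triangle (l + r) + r ∸ triangle (l + r)    ≡⟨ m+n∸m≡n (triangle (l + r)) r ⟩
  r                                          ∎
  where
  l = proj₁ (unpair m)
  r = proj₂ (unpair m)

unpair₁ : ∀ m → diagonal m ∸ proj₂ (unpair m) ≡ proj₁ (unpair m)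
unpair₁ m rewrite diagonal-unpair m = m+n∸n≡m (proj₁ (unpair m)) (proj₂ (unpair m))

module _ {F : Functional n} (F-rec : Recursive F) where

  recursive-pred : Recursive (λ p xs → pred (F p xs))
  recursive-pred = recursive-≗ (λ p xs → lemma (F p xs))
    (recursive-primRec recursive-zero (recursive-var 0F) F-rec)
    where
    lemma : ∀ k → primRec 0 (λ k _ → k) k ≡ pred k
    lemma zero    = refl
    lemma (suc k) = refl

module _ {F G : Functional n} (F-rec : Recursive F) (G-rec : Recursive G) where

  recursive-+ : Recursive (λ p xs → F p xs + G p xs)
  recursive-+ = recursive-≗ (λ p xs → lemma (G p xs) (F p xs))
    (recursive-primRec G-rec (recursive-suc (recursive-var 1F)) F-rec)
    where
    lemma : ∀ b k → primRec b (λ _ → suc) k ≡ k + b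
    lemma b zero    = refl
    lemma b (suc k) = cong suc (lemma b k)

  recursive-∸ : Recursive (λ p xs → F p xs ∸ G p xs)
  recursive-∸ = recursive-≗ (λ p xs → lemma (F p xs) (G p xs))
    (recursive-primRec F-rec (recursive-pred (recursive-var 1F)) G-rec)
    where
    lemma : ∀ b k → primRec b (λ _ → pred) k ≡ b ∸ k
    lemma b zero    = refl
    lemma b (suc k) = trans (cong pred (lemma b k)) (pred[m∸n]≡m∸[1+n] b k)

recursive-triangle : {F : Functional n} → Recursive F → Recursive (λ p xs → triangle (F p xs))
recursive-triangle {F = F} F-rec = recursive-≗ (λ p xs → lemma (F p xs))
  (recursive-primRec recursive-zero
    (recursive-+ (recursive-var 1F) (recursive-suc (recursive-var 0F))) F-rec)
  where
  lemma : ∀ k → primRec 0 (λ k y → y + suc k) k ≡ triangle k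
  lemma zero    = refl
  lemma (suc k) = trans (cong (_+ suc k) (lemma k)) (sym (triangle-suc k))

recursive-⟨⟩ : {F G : Functional n} → Recursive F → Recursive G →
               Recursive (λ p xs → ⟨ F p xs , G p xs ⟩)
recursive-⟨⟩ {F = F} {G} F-rec G-rec = recursive-≗ (λ p xs → sym (⟨⟩-triangle (F p xs) (G p xs)))
  (recursive-+ (recursive-triangle (recursive-+ F-rec G-rec)) G-rec)

recursive-if0 : {C F G : Functional n} → Recursive C → Recursive F → Recursive G →
                Recursive (λ p xs → if0 (C p xs) (F p xs) (G p xs))
recursive-if0 {C = C} {F} {G} C-rec F-rec G-rec =
  recursive-≗ (λ p xs → lemma (F p xs) (G p xs) (C p xs))
    (recursive-primRec F-rec (recursive-weaken (recursive-weaken G-rec)) C-rec)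
  where
  lemma : ∀ a b k → primRec a (λ _ _ → b) k ≡ if0 k a b
  lemma a b zero    = refl
  lemma a b (suc k) = refl

module _ {F : Functional n} (F-rec : Recursive F) where

  recursive-diagonal : Recursive (λ p xs → diagonal (F p xs))
  recursive-diagonal = recursive-primRec recursive-zero
    (recursive-if0
      (recursive-∸ (recursive-triangle (recursive-suc (recursive-var 1F))) (recursive-suc (recursive-var 0F)))
      (recursive-suc (recursive-var 1F)) (recursive-var 1F)) F-rec

  recursive-unpair₂ : Recursive (λ p xs → proj₂ (unpair (F p xs)))
  recursive-unpair₂ = recursive-≗ (λ p xs → unpair₂ (F p xs))
    (recursive-∸ F-rec (recursive-triangle recursive-diagonal))

  recursive-unpair₁ : Recursive (λ p xs → proj₁ (unpair (F p xs)))
  recursive-unpair₁ = recursive-≗ (λ p xs → unpair₁ (F p xs))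
    (recursive-∸ recursive-diagonal recursive-unpair₂)

-- Subsequences of p − 1

-- The index in p - 1 that the letter given by p(j) receives if p(j) is nonzero.
count : Baire → ℕ → ℕ
count p = primRec 0 λ j c → if0 (p j) c (suc c)

-- The absolute difference, serving as a primitive recursive test of equality.
distance : ℕ → ℕ → ℕ
distance i j = (i ∸ j) + (j ∸ i)

-- 0 while the letter of index i of p − 1 has not yet appeared in p(0), …, p(j − 1), and its
-- successor from then on; at most one summand is nonzero.
entry : Baire → ℕ → ℕ → ℕ
entry p i = primRec 0 λ j v → v + if0 (distance (count p j) i) (p j) 0

-- The number o of letters written before stage j. It also says which letter is awaited at stage j,
-- namely the one of index φ(o).
emitted : Baire → (ℕ → ℕ) → ℕ → ℕ
emitted p φ = primRec 0 λ j o → if0 (entry p (φ o) j) o (suc o)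

subsequence : Baire → (ℕ → ℕ) → Baire
subsequence p φ j = entry p (φ (emitted p φ j)) j

recursive-count : {C J : Functional n} → Recursive C → Recursive J →
                  Recursive (λ p xs → count (component p (C p xs)) (J p xs))
recursive-count C-rec = recursive-primRec recursive-zero
  (recursive-if0
    (recursive-oracle (recursive-⟨⟩ (recursive-weaken (recursive-weaken C-rec)) (recursive-var 0F)))
    (recursive-var 1F) (recursive-suc (recursive-var 1F)))

recursive-entry : {C I J : Functional n} → Recursive C → Recursive I → Recursive J →
                  Recursive (λ p xs → entry (component p (C p xs)) (I p xs) (J p xs))
recursive-entry {C = C} {I} C-rec I-rec = recursive-primRec recursive-zero
  (recursive-+ (recursive-var 1F)
    (recursive-if0
      (recursive-+ (recursive-∸ cnt I′) (recursive-∸ I′ cnt))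
      (recursive-oracle (recursive-⟨⟩ C′ (recursive-var 0F)))
      recursive-zero))
  where
  C′  = recursive-weaken (recursive-weaken C-rec)
  I′  = recursive-weaken (recursive-weaken I-rec)
  cnt = recursive-count C′ (recursive-var 0F)

recursive-subsequence : {C J : Functional n} {Φ : Functional (suc n)} →
  Recursive C → Recursive Φ → Recursive J →
  Recursive (λ p xs → subsequence (component p (C p xs)) (λ i → Φ p (i ∷ xs)) (J p xs))
recursive-subsequence {C = C} {J} {Φ} C-rec Φ-rec J-rec =
  recursive-entry C-rec (recursive-let Φ-rec recursive-emitted) J-rec
  where
  Φ′ : Recursive (λ p xs → Φ p (lookup xs 1F ∷ tail (tail xs)))
  Φ′ = recursive-≗ (λ { p (k ∷ y ∷ xs) → refl }) (recursive-weaken Φ-rec)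

  recursive-emitted : Recursive (λ p xs → emitted (component p (C p xs)) (λ i → Φ p (i ∷ xs)) (J p xs))
  recursive-emitted = recursive-primRec recursive-zero
    (recursive-if0
      (recursive-entry (recursive-weaken (recursive-weaken C-rec)) Φ′ (recursive-var 0F))
      (recursive-var 1F) (recursive-suc (recursive-var 1F)))
    J-rec

-- Correctness of the subsequence operator

-- Letters are shifted by one, so that 0 can mean that the letter is missing, as it does in `entry`.
nth : List ℕ → ℕ → ℕ
nth []       i       = 0
nth (x ∷ xs) zero    = suc x
nth (x ∷ xs) (suc i) = nth xs i

nth-++ : ∀ xs ys i → nth xs i ≡ 0 ⊎ nth xs i ≡ nth (xs ++ ys) i
nth-++ []       ys i       = inj₁ refl
nth-++ (x ∷ xs) ys zero    = inj₂ refl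
nth-++ (x ∷ xs) ys (suc i) = nth-++ xs ys i

-- Mirrors the recursion step of `entry`: an appended letter is seen only at index `length xs`,
-- where the first summand is 0.
nth-++-letter : ∀ xs a i → nth (xs ++ letter a) i ≡ nth xs i + if0 (distance (length xs) i) a 0
nth-++-letter []       zero    zero    = refl
nth-++-letter []       zero    (suc i) = refl
nth-++-letter []       (suc a) zero    = refl
nth-++-letter []       (suc a) (suc i) = refl
nth-++-letter (x ∷ xs) a       zero    = sym (+-identityʳ _)
nth-++-letter (x ∷ xs) a       (suc i) = nth-++-letter xs a i

nth-applyUpTo : ∀ (q : Baire) i w → nth (applyUpTo q (suc i) ++ w) i ≡ suc (q i)
nth-applyUpTo q zero    w = refl
nth-applyUpTo q (suc i) w = nth-applyUpTo (q ∘ suc) i w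

decrementUpTo-suc : ∀ p j → decrementUpTo p (suc j) ≡ decrementUpTo p j ++ letter (p j)
decrementUpTo-suc p j = begin
  concatMap letter (applyUpTo p (suc j))        ≡⟨ cong (concatMap letter) (applyUpTo-∷ʳ p j) ⟨
  concatMap letter (applyUpTo p j ++ p j ∷ [])  ≡⟨ concatMap-++ letter (applyUpTo p j) (p j ∷ []) ⟩
  decrementUpTo p j ++ letter (p j) ++ []       ≡⟨ cong (decrementUpTo p j ++_) (++-identityʳ (letter (p j))) ⟩
  decrementUpTo p j ++ letter (p j)             ∎

length-decrementUpTo : ∀ p j → length (decrementUpTo p j) ≡ count p j
length-decrementUpTo p zero = refl
length-decrementUpTo p (suc j)
  rewrite decrementUpTo-suc p j
        | length-++ (decrementUpTo p j) {letter (p j)}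
        | length-decrementUpTo p j
  with p j
... | zero  = +-identityʳ _
... | suc _ = +-comm _ 1

entry-nth : ∀ p i j → entry p i j ≡ nth (decrementUpTo p j) i
entry-nth p i zero = refl
entry-nth p i (suc j)
  rewrite decrementUpTo-suc p j
        | nth-++-letter (decrementUpTo p j) (p j) i
        | length-decrementUpTo p j
        | entry-nth p i j = refl

-- Every finite stage sees a prefix of the same word, and later stages only extend it. The first
-- half guarantees that waiting for a letter ends, the second that no wrong letter is ever written.
entry-stable : ∀ {p q} → p −1≐ q → ∀ i → ∃ λ m →
               (∀ j → entry p i (m + j) ≡ suc (q i)) × (∀ j → entry p i j ≡ 0 ⊎ entry p i j ≡ suc (q i))
entry-stable {p} {q} pq i with m , w , eq ← pq (suc i) =
  m , (λ j → present (m≤m+n m j)) , partial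
  where
  present : ∀ {j} → m ≤ j → entry p i j ≡ suc (q i)
  present {j} m≤j with v , ext ← decrementUpTo-mono p m≤j = begin
    entry p i j                                 ≡⟨ entry-nth p i j ⟩
    nth (decrementUpTo p j) i                   ≡⟨ cong (λ u → nth u i) ext ⟩
    nth (decrementUpTo p m ++ v) i              ≡⟨ cong (λ u → nth (u ++ v) i) eq ⟩
    nth ((applyUpTo q (suc i) ++ w) ++ v) i     ≡⟨ cong (λ u → nth u i) (++-assoc (applyUpTo q (suc i)) w v) ⟩
    nth (applyUpTo q (suc i) ++ w ++ v) i       ≡⟨ nth-applyUpTo q i (w ++ v) ⟩
    suc (q i)                                   ∎

  partial : ∀ j → entry p i j ≡ 0 ⊎ entry p i j ≡ suc (q i)
  partial j with ≤-total m j
  ... | inj₁ m≤j = inj₂ (present m≤j)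
  ... | inj₂ j≤m with v , ext ← decrementUpTo-mono p j≤m with nth-++ (decrementUpTo p j) v i
  ...   | inj₁ absent = inj₁ (trans (entry-nth p i j) absent)
  ...   | inj₂ same   = inj₂ (begin
    entry p i j                     ≡⟨ entry-nth p i j ⟩
    nth (decrementUpTo p j) i       ≡⟨ same ⟩
    nth (decrementUpTo p j ++ v) i  ≡⟨ cong (λ u → nth u i) ext ⟨
    nth (decrementUpTo p m) i       ≡⟨ entry-nth p i m ⟨
    entry p i m                     ≡⟨ present ≤-refl ⟩
    suc (q i)                       ∎)

module _ {p q : Baire} (pq : p −1≐ q) (φ : ℕ → ℕ) where

  decrementUpTo-subsequence : ∀ j →
    decrementUpTo (subsequence p φ) j ≡ applyUpTo (q ∘ φ) (emitted p φ j)
  decrementUpTo-subsequence zero = refl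
  decrementUpTo-subsequence (suc j)
    rewrite decrementUpTo-suc (subsequence p φ) j | decrementUpTo-subsequence j
    -- The value written at stage j is either 0, which adds no letter, or the successor of the
    -- awaited letter.
    with entry p (φ (emitted p φ j)) j | proj₂ (proj₂ (entry-stable pq (φ (emitted p φ j)))) j
  ... | _ | inj₁ refl = ++-identityʳ _
  ... | _ | inj₂ refl = applyUpTo-∷ʳ (q ∘ φ) (emitted p φ j)

  emitted-step : ∀ j → emitted p φ (suc j) ≡ emitted p φ j ⊎ emitted p φ (suc j) ≡ suc (emitted p φ j)
  emitted-step j with entry p (φ (emitted p φ j)) j
  ... | zero  = inj₁ refl
  ... | suc _ = inj₂ refl

  emitted-surjective : ∀ k → ∃ λ j → emitted p φ j ≡ k
  emitted-surjective zero = 0 , refl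
  emitted-surjective (suc k)
    with j , eq ← emitted-surjective k
    with m , present , _ ← entry-stable pq (φ k)
    with wait m
    where
    -- The counter moves by at most one, so it cannot leave k without hitting k + 1.
    wait : ∀ d → emitted p φ (d + j) ≡ k ⊎ ∃ λ j′ → emitted p φ j′ ≡ suc k
    wait zero = inj₁ eq
    wait (suc d) with wait d
    ... | inj₂ done = inj₂ done
    ... | inj₁ eq′ with emitted-step (d + j)
    ...   | inj₁ stay = inj₁ (trans stay eq′)
    ...   | inj₂ move = inj₂ (suc (d + j) , trans move (cong suc eq′))
  ... | inj₂ done = done
  -- From stage m on the letter of index φ(k) is visible, so if it is still awaited at stage m + j,
  -- it is written there.
  ... | inj₁ eq′  = suc (m + j) , (begin
    if0 (entry p (φ o) (m + j)) o (suc o)  ≡⟨ cong (λ o → if0 (entry p (φ o) (m + j)) o (suc o)) eq′ ⟩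
    if0 (entry p (φ k) (m + j)) k (suc k)  ≡⟨ cong (λ v → if0 v k (suc k)) (present j) ⟩
    suc k                                  ∎)
    where o = emitted p φ (m + j)

  subsequence-−1≐ : subsequence p φ −1≐ q ∘ φ
  subsequence-−1≐ k with j , eq ← emitted-surjective k = j , [] , (begin
    decrementUpTo (subsequence p φ) j         ≡⟨ decrementUpTo-subsequence j ⟩
    applyUpTo (q ∘ φ) (emitted p φ j)         ≡⟨ cong (applyUpTo (q ∘ φ)) eq ⟩
    applyUpTo (q ∘ φ) k                       ≡⟨ ++-identityʳ _ ⟨
    applyUpTo (q ∘ φ) k ++ []                 ∎)

-- Flattening nested completions

decrementUpTo-pred : ∀ p j → decrementUpTo (pred ∘ p) j ≡ concatMap letter (decrementUpTo p j)
decrementUpTo-pred p zero = refl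
decrementUpTo-pred p (suc j) with p 0
... | zero  = decrementUpTo-pred (p ∘ suc) j
... | suc a = cong (letter a ++_) (decrementUpTo-pred (p ∘ suc) j)

-- An entry 0 of p vanishes at the first decrement and an entry 1 at the second, and `pred` sends
-- both to 0. Hence (p - 1) - 1 is a single decrement of `pred ∘ p`.
pred-−1≐ : ∀ {p q q′} → p −1≐ q → q −1≐ q′ → pred ∘ p −1≐ q′
pred-−1≐ {p} {q} {q′} pq qq′ k with m , w , eq ← qq′ k with m′ , w′ , eq′ ← pq m =
  m′ , w ++ concatMap letter w′ , (begin
    decrementUpTo (pred ∘ p) m′                    ≡⟨ decrementUpTo-pred p m′ ⟩
    concatMap letter (decrementUpTo p m′)          ≡⟨ cong (concatMap letter) eq′ ⟩
    concatMap letter (applyUpTo q m ++ w′)         ≡⟨ concatMap-++ letter (applyUpTo q m) w′ ⟩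
    decrementUpTo q m ++ concatMap letter w′       ≡⟨ cong (_++ concatMap letter w′) eq ⟩
    (applyUpTo q′ k ++ w) ++ concatMap letter w′   ≡⟨ ++-assoc (applyUpTo q′ k) w _ ⟩
    applyUpTo q′ k ++ w ++ concatMap letter w′     ∎)

-- Reductions

RecursiveOperator : (Baire → Baire) → Set
RecursiveOperator Φ = Recursive {1} (λ p xs → Φ p (lookup xs 0F))

recursive-tuple : (F : Baire → ℕ → Baire) → Recursive (λ p xs → F p (lookup xs 0F) (lookup xs 1F)) →
                  RecursiveOperator (λ p → tuple (F p))
recursive-tuple F F-rec = recursive-comp F-rec
  (recursive-unpair₁ (recursive-var 0F) ∷ recursive-unpair₂ (recursive-var 0F) ∷ [])

recursive-tuple² : (F : Baire → ℕ → ℕ → Baire) →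
                   Recursive (λ p xs → F p (lookup xs 0F) (lookup xs 1F) (lookup xs 2F)) →
                   RecursiveOperator (λ p → tuple λ n → tuple (F p n))
recursive-tuple² F F-rec = recursive-tuple (λ p n → tuple (F p n)) (recursive-comp F-rec
  (recursive-var 0F ∷ recursive-unpair₁ (recursive-var 1F) ∷ recursive-unpair₂ (recursive-var 1F) ∷ []))

component-tuple² : ∀ (ps : ℕ → ℕ → Baire) n k →
                   component (component (tuple λ n → tuple (ps n)) n) k ≗ ps n k
component-tuple² ps n k i =
  trans (component-tuple (λ n → tuple (ps n)) n ⟨ k , i ⟩) (component-tuple (ps n) k i)

module _ (Φ : Baire → Baire) (Φ-rec : RecursiveOperator Φ) where

  operator-cong : ∀ {p p′} → p ≗ p′ → Φ p ≗ Φ p′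
  operator-cong {p} {p′} p≗p′ i =
    ⇓-deterministic p≗p′ (Φ-rec .computes p (i ∷ [])) (Φ-rec .computes p′ (i ∷ []))

  totalMap : PartialMap 𝔹 𝔹 ℓ
  totalMap = record
    { graph        = λ p q → Lift _ (q ≗ Φ p)
    ; respects     = λ p≗p′ q≗q′ (lift q≗Φp) →
                       lift λ i → trans (sym (q≗q′ i)) (trans (q≗Φp i) (operator-cong p≗p′ i))
    ; singleValued = λ (lift q≗Φp) (lift q′≗Φp) i → trans (q≗Φp i) (sym (q′≗Φp i))
    }

  totalMap-computable : Computable (totalMap {ℓ})
  totalMap-computable = Φ-rec .code , λ {p} (lift q≗Φp) i →
    subst (λ y → p ⊢ Φ-rec .code · i ∷ [] ⇓ y) (sym (q≗Φp i)) (Φ-rec .computes p (i ∷ []))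

module _ {X Y X′ Y′ : RepresentedSpace ℓ} (f : Problem X Y) (g : Problem X′ Y′) where
  private
    module X  = RepresentedSpace X
    module Y  = RepresentedSpace Y
    module X′ = RepresentedSpace X′
    module Y′ = RepresentedSpace Y′
    module f = Problem f
    module g = Problem g

  -- Since the backward condition ranges over all names of all solutions of x′, it covers the output
  -- of every realizer of g at once.
  ≤ₛW-totalMap : (H K : Baire → Baire) → RecursiveOperator H → RecursiveOperator K →
    (∀ {p x} → p X.names x → f.Dom x → ∃ λ x′ → K p X′.names x′ × g.Dom x′ ×
       (∀ {r y′} → r Y′.names y′ → x′ g.↦ y′ → ∃ λ y → H r Y.names y × x f.↦ y)) →
    f ≤ₛW g
  ≤ₛW-totalMap H K H-rec K-rec reduce =
    totalMap H H-rec , totalMap K K-rec , totalMap-computable H H-rec , totalMap-computable K K-rec ,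
    λ G G-realizes names dom →
      let x′ , Kp-names , dom′ , back    = reduce names dom
          r , y′ , graph , r-names , x′↦y′ = G-realizes Kp-names dom′
          y , Hr-names , x↦y             = back r-names x′↦y′
      in H r , y , (r , (_ , lift (λ _ → refl) , graph) , lift (λ _ → refl)) , Hr-names , x↦y

module _ {X Y : RepresentedSpace ℓ} (f : Problem X Y) where
  private
    module X = RepresentedSpace X
    module Y = RepresentedSpace Y
    module f = Problem f

  f≤Πf : f ≤ₛW Π f
  f≤Πf = ≤ₛW-totalMap f (Π f)
    (λ r → component r 0) (λ p → tuple (λ _ → p))
    (recursive-oracle (recursive-⟨⟩ recursive-zero (recursive-var 0F)))
    (recursive-oracle (recursive-unpair₂ (recursive-var 0F)))
    λ {p} {x} names (y , x↦y) →
      (λ _ → x) ,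
      (λ n → X.names-resp (λ k → sym (component-tuple (λ _ → p) n k)) (Setoid.refl X.setoid) names) ,
      ((λ _ → y) , λ _ → x↦y) ,
      λ names′ xs↦ys → _ , names′ 0 , xs↦ys 0

  -- Only instance 0 is solved, and its answer is repeated in all places. It may be wrong elsewhere,
  -- since one correct place suffices; `suc ∘ r` lifts the name to the completion.
  Σf≤f : Σ f ≤ₛW f
  Σf≤f = ≤ₛW-totalMap (Σ f) f
    (λ r → tuple (λ _ → suc ∘ r)) (λ p → component p 0)
    (recursive-suc (recursive-oracle (recursive-unpair₂ (recursive-var 0F))))
    (recursive-oracle (recursive-⟨⟩ recursive-zero (recursive-var 0F)))
    λ names (_ , dom , _) →
      _ , names 0 , dom 0 ,
      λ {r} {y} names′ x↦y →
        (λ _ → just y) ,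
        (λ n → r , −1≐-resp (λ k → sym (component-tuple (λ _ → suc ∘ r) n k)) (λ _ → refl) (suc∘-−1≐ r) , names′) ,
        dom , 0 , just x↦y

  -- However the point `y⊥` was obtained, uniqueness of names forces it to be the solution that p -
  -- 1 already names.
  names-completion-hit : ∀ {x p q y y⊥} → p −1≐ q → q Y.names y → x f.↦ y →
                         RepresentedSpace._names_ (completion Y) p y⊥ → Any (x f.↦_) y⊥
  names-completion-hit {y⊥ = just _} pq qy x↦y (_ , pq′ , q′y′) =
    just (f.↦-resp (Setoid.refl X.setoid)
      (Y.names-unique qy (Y.names-resp (−1≐-unique pq′ pq) (Setoid.refl Y.setoid) q′y′)) x↦y)
  names-completion-hit {y⊥ = nothing} pq qy x↦y undefined = ⊥-elim (undefined (_ , _ , pq , qy))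

module _ (em : ExcludedMiddle ℓ) {X Y X′ Y′ : RepresentedSpace ℓ}
         (f : Problem X Y) (g : Problem X′ Y′) where
  private
    module X  = RepresentedSpace X
    module Y  = RepresentedSpace Y
    module Ȳ  = RepresentedSpace (completion Y)
    module X′ = RepresentedSpace X′
    module Y′ = RepresentedSpace Y′
    module Ȳ′ = RepresentedSpace (completion Y′)
    module f = Problem f
    module g = Problem g

  -- Wherever H produces junk, excluded middle still provides a point of the completion that it
  -- names, so only one correct column per row has to be checked.
  ΠΣ≤Σ : (H : Baire → ℕ → ℕ → Baire) (K : Baire → ℕ → Baire) →
    Recursive (λ r xs → H r (lookup xs 0F) (lookup xs 1F) (lookup xs 2F)) →
    Recursive (λ p xs → K p (lookup xs 0F) (lookup xs 1F)) →
    (∀ {p} {x : ℕ → ℕ → X.Carrier} →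
       (∀ n k → component (component p n) k X.names x n k) → (∀ n k → f.Dom (x n k)) →
       ∃ λ x′ → (∀ m → K p m X′.names x′ m) × (∀ m → g.Dom (x′ m)) ×
       (∀ {r m q y′} → component r m −1≐ q → q Y′.names y′ → x′ m g.↦ y′ → ∀ n →
          ∃ λ k → ∃₂ λ q′ y → H r n k −1≐ q′ × q′ Y.names y × x n k f.↦ y)) →
    Π (Σ f) ≤ₛW Σ g
  ΠΣ≤Σ H K H-rec K-rec reduce = ≤ₛW-totalMap (Π (Σ f)) (Σ g)
    (λ r → tuple λ n → tuple (H r n)) (λ p → tuple (K p))
    (recursive-tuple² H H-rec) (recursive-tuple K K-rec) λ {p} names (_ , solvable) →
      let dom n                   = proj₁ (solvable n)
          x′ , names′ , dom′ , back = reduce names dom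
      in x′ ,
         (λ m → X′.names-resp (λ i → sym (component-tuple (K p) m i)) (Setoid.refl X′.setoid) (names′ m)) ,
         ((λ m → just (proj₁ (dom′ m))) , dom′ , 0 , just (proj₂ (dom′ 0))) ,
         λ {r} r-names (_ , m , hit) →
           let value n k = completion-total em Y (component (component (tuple λ n → tuple (H r n)) n) k) in
           (λ n k → proj₁ (value n k)) ,
           (λ n k → proj₂ (value n k)) ,
           λ n → dom n , transfer (r-names m) hit (λ rq qy′ x′↦y′ → back rq qy′ x′↦y′ n)
                           (component-tuple² (H r) n) (λ k → proj₂ (value n k))
    where
    -- Matching on the hit excludes ⊥, so r - 1 is infinite and names a genuine solution, to which
    -- `back` applies.
    transfer : ∀ {r x′ y′⊥} {x : ℕ → X.Carrier} {h s : ℕ → Baire} {y⊥ : ℕ → Maybe Y.Carrier} →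
      r Ȳ′.names y′⊥ → Any (x′ g.↦_) y′⊥ →
      (∀ {q y′} → r −1≐ q → q Y′.names y′ → x′ g.↦ y′ →
         ∃ λ k → ∃₂ λ q′ y → h k −1≐ q′ × q′ Y.names y × x k f.↦ y) →
      (∀ k → s k ≗ h k) → (∀ k → s k Ȳ.names y⊥ k) →
      ∃ λ k → Any (x k f.↦_) (y⊥ k)
    transfer (_ , rq , qy′) (just x′↦y′) back s≗h names
      with k , _ , _ , hq′ , q′y , x↦y ← back rq qy′ x′↦y′ =
      k , names-completion-hit f (−1≐-resp (λ i → sym (s≗h k i)) (λ _ → refl) hq′) q′y x↦y (names k)

-- The three reductions to stashed problems

module _ (em : ExcludedMiddle ℓ) {X Y : RepresentedSpace ℓ} (f : Problem X Y) where
  private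
    module X = RepresentedSpace X
    module Y = RepresentedSpace Y

  ΠΣf≤ΣΠf : Π (Σ f) ≤ₛW Σ (Π f)
  ΠΣf≤ΣΠf = ΠΣ≤Σ em f (Π f)
    (λ r n k → subsequence (component r k) (λ i → ⟨ n , i ⟩))
    (λ p k → tuple λ n → component (component p n) k)
    (recursive-subsequence (recursive-var 1F) (recursive-⟨⟩ (recursive-var 1F) (recursive-var 0F))
      (recursive-var 2F))
    (recursive-oracle (recursive-⟨⟩ (recursive-unpair₁ (recursive-var 1F))
      (recursive-⟨⟩ (recursive-var 0F) (recursive-unpair₂ (recursive-var 1F)))))
    λ {p} {x} names dom →
      (λ k n → x n k) ,
      (λ k n → X.names-resp
                 (λ i → sym (component-tuple (λ n → component (component p n) k) n i))
                 (Setoid.refl X.setoid) (names n k)) ,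
      (λ k → (λ n → proj₁ (dom n k)) , λ n → proj₂ (dom n k)) ,
      -- One correct place k serves all rows n. The selected subsequence `q ∘ ⟨ n ,_⟩` is
      -- `component q n` by definition.
      λ {r} {k} rq qy x↦y n → k , _ , _ , subsequence-−1≐ rq (λ i → ⟨ n , i ⟩) , qy n , x↦y n

  ΠΣΠf≤ΣΠf : Π (Σ (Π f)) ≤ₛW Σ (Π f)
  ΠΣΠf≤ΣΠf = ΠΣ≤Σ em (Π f) (Π f)
    (λ r n k → subsequence (component r k) (φ n))
    (λ p k → tuple (row p k))
    (recursive-subsequence (recursive-var 1F)
      (recursive-⟨⟩ (recursive-⟨⟩ (recursive-var 1F) (recursive-unpair₁ (recursive-var 0F)))
        (recursive-unpair₂ (recursive-var 0F)))
      (recursive-var 2F))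
    (recursive-oracle (recursive-⟨⟩ (recursive-unpair₁ (recursive-unpair₁ (recursive-var 1F)))
      (recursive-⟨⟩ (recursive-var 0F)
        (recursive-⟨⟩ (recursive-unpair₂ (recursive-unpair₁ (recursive-var 1F)))
          (recursive-unpair₂ (recursive-var 1F))))))
    λ {p} {x} names dom →
      -- Column k consists of one sequence for each row; t = ⟨n, l⟩ runs through all their members.
      (λ k t → x (proj₁ (unpair t)) k (proj₂ (unpair t))) ,
      (λ k t → X.names-resp (λ i → sym (component-tuple (row p k) t i)) (Setoid.refl X.setoid)
                 (names (proj₁ (unpair t)) k (proj₂ (unpair t)))) ,
      (λ k → (λ t → proj₁ (dom (proj₁ (unpair t)) k) (proj₂ (unpair t))) ,
             λ t → proj₂ (dom (proj₁ (unpair t)) k) (proj₂ (unpair t))) ,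
      λ {r} {k} {q} {y} rq qy x↦y n →
        k , q ∘ φ n , (λ l → y ⟨ n , l ⟩) , subsequence-−1≐ rq (φ n) ,
        (λ l → Y.names-resp (λ i → sym (cong (λ t → q ⟨ ⟨ n , proj₁ t ⟩ , proj₂ t ⟩) (unpair-⟨⟩ l i)))
                 (Setoid.refl Y.setoid) (qy ⟨ n , l ⟩)) ,
        λ l → subst (λ t → Problem._↦_ f (x (proj₁ t) k (proj₂ t)) (y ⟨ n , l ⟩)) (unpair-⟨⟩ n l)
                (x↦y ⟨ n , l ⟩)
    where
    row : Baire → ℕ → ℕ → Baire
    row p k t = component (component (component p (proj₁ (unpair t))) k) (proj₂ (unpair t))

    -- In a name of the n-th solution sequence, position i = ⟨l, j⟩ holds digit j of member l. In
    -- the merged answer that digit sits at ⟨⟨n, l⟩, j⟩.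
    φ : ℕ → ℕ → ℕ
    φ n i = ⟨ ⟨ n , proj₁ (unpair i) ⟩ , proj₂ (unpair i) ⟩

  -- Entry ⟨m, k⟩ of row n becomes entry k of row n in block m. If block m is answered correctly,
  -- every row has a correct entry in that block, though its k may vary with the row.
  ΠΣf≤ΣΠΣf : Π (Σ f) ≤ₛW Σ (Π (Σ f))
  ΠΣf≤ΣΠΣf = ΠΣ≤Σ em f (Π (Σ f))
    -- An answer is wrapped in two completions. `subsequence` reads through the outer one but writes
    -- a shifted name again, and `pred` merges this shift with the inner one.
    (λ r n t → pred ∘ subsequence (component r (proj₁ (unpair t))) (φ n t))
    (λ p m → tuple λ n → tuple (cell p m n))
    (recursive-pred (recursive-subsequence (recursive-unpair₁ (recursive-var 1F))
      (recursive-⟨⟩ (recursive-var 1F)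
        (recursive-⟨⟩ (recursive-unpair₂ (recursive-var 2F)) (recursive-var 0F)))
      (recursive-var 2F)))
    (recursive-oracle (recursive-⟨⟩ (recursive-unpair₁ (recursive-var 1F))
      (recursive-⟨⟩
        (recursive-⟨⟩ (recursive-var 0F) (recursive-unpair₁ (recursive-unpair₂ (recursive-var 1F))))
        (recursive-unpair₂ (recursive-unpair₂ (recursive-var 1F))))))
    λ {p} {x} names dom →
      (λ m n k → x n ⟨ m , k ⟩) ,
      (λ m n k → X.names-resp (λ i → sym (component-tuple² (cell p m) n k i)) (Setoid.refl X.setoid)
                   (names n ⟨ m , k ⟩)) ,
      (λ m → (λ n k → just (proj₁ (dom n ⟨ m , k ⟩))) ,
             λ n → (λ k → dom n ⟨ m , k ⟩) , 0 , just (proj₂ (dom n ⟨ m , 0 ⟩))) ,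
      λ {r} {m} {q} rq qy x↦y n →
        let _ , k , hit     = x↦y n
            q′ , y , qq′ , q′y , x↦y′ = named (qy n k) hit
        in ⟨ m , k ⟩ , q′ , y ,
           -- The output place t is decoded into block and entry, and at t = ⟨m, k⟩ this gives back
           -- the correct block m and its hit k.
           subst (λ t → pred ∘ subsequence (component r (proj₁ t)) (λ i → ⟨ n , ⟨ proj₂ t , i ⟩ ⟩) −1≐ q′)
             (sym (unpair-⟨⟩ m k)) (pred-−1≐ (subsequence-−1≐ rq (λ i → ⟨ n , ⟨ k , i ⟩ ⟩)) qq′) ,
           q′y , x↦y′
    where
    cell : Baire → ℕ → ℕ → ℕ → Baire
    cell p m n k = component (component p n) ⟨ m , k ⟩

    φ : ℕ → ℕ → ℕ → ℕ
    φ n t i = ⟨ n , ⟨ proj₂ (unpair t) , i ⟩ ⟩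

    named : ∀ {q x y⊥} → RepresentedSpace._names_ (completion Y) q y⊥ → Any (Problem._↦_ f x) y⊥ →
            ∃₂ λ q′ y → q −1≐ q′ × q′ Y.names y × Problem._↦_ f x y
    named (q′ , qq′ , q′y) (just x↦y) = q′ , _ , qq′ , q′y , x↦y

proposition3p2 : ∀ {ℓ} → ExcludedMiddle ℓ →
    {X Y : RepresentedSpace ℓ} (f : Problem X Y) →
    (Π (Σ f) ≤ₛW Σ (Π f)) ×
    (Π (Σ (Π f)) ≡ₛW Σ (Π f)) ×
    (Σ (Π (Σ f)) ≡ₛW Π (Σ f))
proposition3p2 em f =
  ΠΣf≤ΣΠf em f ,
  (ΠΣΠf≤ΣΠf em f , f≤Πf (Σ (Π f))) ,
  (Σf≤f (Π (Σ f)) , ΠΣf≤ΣΠΣf em f)
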